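{- Let $n\ge 1$ and $\overline{R}$ be integers with $0\le \overline{R}\le n$, and let $n_{\overline{R}}:=\overline{R}(\overline{R}+1)/2$. Then $K^+(n,n-\overline{R})\ge \overline{R}+1$, with equality when $n\ge n_{\overline{R}}$. Furthermore, $n_{\overline{R}}$ is the least value for which equality holds, in the sense that $K^+(n,n-\overline{R})>\overline{R}+1$ whenever $n<n_{\overline{R}}$.
   Context: $Q_n=\{0,1\}^n$ is ordered by $x\preceq y$ iff $x_i\le y_i$ for all $i$, and $d(x,y)$ is the Hamming distance. The downward directed ball is $B_n^-(x,R)=\{y\in Q_n: y\preceq x,\ d(x,y)\le R\}$. A set $\mathcal{C}\subseteq Q_n$ downward $R$-covers $Q_n$ if $Q_n=\bigcup_{c\in\mathcal{C}}B_n^-(c,R)$. $K^+(n,R)$ denotes the minimum size of a set $\mathcal{C}\subseteq Q_n$ that downward $R$-covers $Q_n$ (in particular $K^+(n,R)=1$ for $R\ge n$). -}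

module Defs where

open import Data.Bool.Base as Bool using (Bool; true; false; _xor_)
import Data.Bool.Properties as Bool
open import Data.Empty using (⊥)
open import Data.List.Base as List using (List; []; _∷_; _++_; length)
open import Data.List.Membership.Propositional using (find; lose) renaming (_∈_ to _∈ᴸ_)
open import Data.List.Membership.Propositional.Properties
  using (∈-map⁺; ∈-map⁻; ∈-++⁺ˡ; ∈-++⁺ʳ)
open import Data.List.Relation.Unary.All as All using (all?)
open import Data.List.Relation.Unary.AllPairs as AllPairs using ()
open import Data.List.Relation.Unary.Any using (Any; any?; here)
open import Data.List.Relation.Unary.Unique.Propositional using (Unique)
import Data.List.Relation.Unary.Unique.DecPropositional as DecUnique
import Data.List.Relation.Unary.Unique.Propositional.Properties as Unique
open import Data.Nat.Base using (ℕ; zero; suc; _≤_; z≤n; s≤s)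
open import Data.Nat.Properties using (_≤?_; suc-injective)
open import Data.Product using (∃; _×_; _,_; proj₁; proj₂)
open import Data.Vec.Base using (Vec; []; _∷_; zipWith; count)
import Data.Vec.Properties as Vec
open import Data.Vec.Relation.Binary.Pointwise.Inductive as Pointwise using (Pointwise)
open import Level using (0ℓ)
open import Relation.Binary.PropositionalEquality using (_≡_; refl; cong)
open import Relation.Nullary using (Dec; yes; no; contradiction)
open import Relation.Nullary.Decidable using (map′; T?; _×-dec_)
open import Relation.Unary using (Pred; Decidable; _∈_)

Q : ℕ → Set
Q n = Vec Bool n

infix 4 _⪯_

_⪯_ : ∀ {n} → Q n → Q n → Set
_⪯_ = Pointwise Bool._≤_

d : ∀ {n} → Q n → Q n → ℕ
d x y = count T? (zipWith _xor_ x y)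

B⁻ : ∀ {n} → Q n → ℕ → Pred (Q n) 0ℓ
B⁻ x R y = y ⪯ x × d x y ≤ R

DownwardCovers : ∀ {n} → ℕ → List (Q n) → Set
DownwardCovers R C = ∀ y → Any (λ c → y ∈ B⁻ c R) C

-- A subset of Q n of size k is given by a repetition-free list of length k.
HasCoverOfSize : ℕ → ℕ → Pred ℕ 0ℓ
HasCoverOfSize n R k =
  ∃ λ (C : List (Q n)) → length C ≡ k × Unique C × DownwardCovers R C

IsMinimum : Pred ℕ 0ℓ → Pred ℕ 0ℓ
IsMinimum P m = P m × (∀ k → P k → m ≤ k)

-- The rest shows that the minimum defining K⁺ exists: Q n covers itself, and
-- having a cover of a given size is decidable by exhaustive search.

words : ∀ n → List (Q n)
words zero    = [] ∷ []
words (suc n) = List.map (false ∷_) (words n) ++ List.map (true ∷_) (words n)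

words-complete : ∀ {n} (x : Q n) → x ∈ᴸ words n
words-complete []          = here refl
words-complete (false ∷ x) = ∈-++⁺ˡ (∈-map⁺ (false ∷_) (words-complete x))
words-complete (true  ∷ x) =
  ∈-++⁺ʳ (List.map (false ∷_) (words _)) (∈-map⁺ (true ∷_) (words-complete x))

words-unique : ∀ n → Unique (words n)
words-unique zero    = All.[] AllPairs.∷ AllPairs.[]
words-unique (suc n) = Unique.++⁺
  (Unique.map⁺ Vec.∷-injectiveʳ (words-unique n))
  (Unique.map⁺ Vec.∷-injectiveʳ (words-unique n))
  λ (p , q) → disjoint (∈-map⁻ (false ∷_) p) (∈-map⁻ (true ∷_) q)
  where
  disjoint : ∀ {v} {A B : Pred (Q n) 0ℓ} →
             ∃ (λ x → A x × v ≡ false ∷ x) → ∃ (λ y → B y × v ≡ true ∷ y) → ⊥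
  disjoint (_ , _ , refl) (_ , _ , ())

⪯-refl : ∀ {n} {x : Q n} → x ⪯ x
⪯-refl = Pointwise.refl Bool.≤-refl

d-self : ∀ {n} (x : Q n) → d x x ≡ 0
d-self []          = refl
d-self (false ∷ x) = d-self x
d-self (true  ∷ x) = d-self x

self∈B⁻ : ∀ {n} (x : Q n) R → x ∈ B⁻ x R
self∈B⁻ x R rewrite d-self x = ⪯-refl , z≤n

words-cover : ∀ n R → DownwardCovers R (words n)
words-cover n R y = lose (words-complete y) (self∈B⁻ y R)

_∈B⁻?_ : ∀ {n} {R} (y c : Q n) → Dec (y ∈ B⁻ c R)
_∈B⁻?_ {R = R} y c = Pointwise.decidable Bool._≤?_ y c ×-dec (d c y ≤? R)

downwardCovers? : ∀ {n} R → Decidable (DownwardCovers {n} R)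
downwardCovers? {n} R C =
  map′ (λ p y → All.lookup p (words-complete y)) (λ p → All.universal p (words n))
       (all? (λ y → any? (y ∈B⁻?_) C) (words n))

anyWord? : ∀ {n} {P : Pred (Q n) 0ℓ} → Decidable P → Dec (∃ P)
anyWord? P? = map′ (λ p → let x , _ , px = find p in x , px)
                   (λ (x , px) → lose (words-complete x) px)
                   (any? P? (words _))

anyList? : ∀ {n} k {P : Pred (List (Q n)) 0ℓ} → Decidable P →
           Dec (∃ λ C → length C ≡ k × P C)
anyList? zero    P? = map′ (λ p → [] , refl , p) (λ { ([] , _ , p) → p }) (P? [])
anyList? (suc k) P? =
  map′ (λ (x , C , eq , p) → x ∷ C , cong suc eq , p)
       (λ { (x ∷ C , eq , p) → x , C , suc-injective eq , p })
       (anyWord? λ x → anyList? k λ C → P? (x ∷ C))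

hasCoverOfSize? : ∀ n R → Decidable (HasCoverOfSize n R)
hasCoverOfSize? n R k =
  anyList? k λ C → DecUnique.unique? (Vec.≡-dec Bool._≟_) C ×-dec downwardCovers? R C

minimum : ∀ {P : Pred ℕ 0ℓ} → Decidable P → ∀ n → P n → ∃ (IsMinimum P)
minimum P? n pn with P? 0
... | yes p0 = 0 , p0 , λ _ _ → z≤n
minimum P? zero    pn | no ¬p0 = contradiction pn ¬p0
minimum P? (suc n) pn | no ¬p0 with minimum (λ k → P? (suc k)) n pn
... | m , pm , m≤ = suc m , pm , λ where
  zero    p0 → contradiction p0 ¬p0
  (suc k) pk → s≤s (m≤ k pk)

minimumCoverSize : ∀ n R → ∃ (IsMinimum (HasCoverOfSize n R))
minimumCoverSize n R = minimum (hasCoverOfSize? n R) (length (words n))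
  (words n , refl , words-unique n , words-cover n R)

K⁺ : ℕ → ℕ → ℕ
K⁺ n R = proj₁ (minimumCoverSize n R)

K⁺-isMinimum : ∀ n R → IsMinimum (HasCoverOfSize n R) (K⁺ n R)
K⁺-isMinimum n R = proj₂ (minimumCoverSize n R)

{-# OPTIONS --safe #-}

-- Let C cover Q n with radius n − r.  If y has weight w ≤ r, some c ∈ C above y
-- has at least r − w zeros; adding to y a coordinate where c vanishes gives a
-- word of weight w + 1 that is below neither c nor any word that y already
-- avoided.  Starting from 0, this greedily yields r + 1 distinct words of C, the
-- first r of which have at least r, r − 1, …, 1 zeros.  If n < r + … + 1, two of
-- these r words vanish at a common coordinate, so all r of them are avoided by a
-- word of weight r − 1, and the greedy procedure resumed there finds two more
-- words of C.  Conversely, when n ≥ r + … + 1, disjoint zero sets of sizes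
-- r, …, 1, together with the empty one, give a cover.
module Submission where

open import Defs
open import Data.Bool.Base as Bool using (Bool; true; false; not; f≤t; b≤b; if_then_else_)
open import Data.Fin.Base using (Fin; zero; suc)
open import Data.List.Base using (List; []; _∷_; length; map)
open import Data.List.Membership.Propositional using (find) renaming (_∈_ to _∈ᴸ_)
open import Data.List.Properties using (length-map; length-removeAt′)
open import Data.List.Relation.Unary.All as All using (All; []; _∷_)
import Data.List.Relation.Unary.All.Properties as All
open import Data.List.Relation.Unary.AllPairs using ([]; _∷_)
open import Data.List.Relation.Unary.Any as Any using (here; there; index; _─_)
import Data.List.Relation.Unary.Any.Properties as Any
open import Data.List.Relation.Unary.Unique.Propositional using (Unique)
import Data.List.Relation.Unary.Unique.Propositional.Properties as Unique
open import Data.Nat using (ℕ; zero; suc; z≤n; s≤s; _+_; _*_; _∸_; _/_; _≤_; _<_; _≥_; _>_; _≤?_)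
open import Data.Nat.DivMod using (m*n/n≡m)
open import Data.Nat.ListAction using (sum)
open import Data.Nat.Properties
open import Algebra.Properties.CommutativeSemigroup +-commutativeSemigroup
  using (x∙yz≈y∙xz; xy∙z≈y∙xz)
open import Data.Nat.Tactic.RingSolver using (solve-∀)
open import Data.Product using (∃; ∃₂; _×_; _,_)
open import Data.Sum.Base using (_⊎_; inj₁; inj₂)
open import Data.Vec.Base as Vec
  using ([]; _∷_; _++_; lookup; replicate; countᵇ; tail; splitAt; _[_]≔_)
open import Data.Vec.Properties using (++-injectiveʳ; count≤n; lookup∘update)
open import Data.Vec.Relation.Binary.Pointwise.Inductive as Pointwise using ([]; _∷_)
open import Function.Base using (id)
open import Relation.Binary.PropositionalEquality
open import Relation.Nullary using (¬_; yes; no; contradiction)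
open import Relation.Unary using (_∈_)

private variable
  m n : ℕ

-- Triangular numbers.

triangle : ℕ → ℕ
triangle zero    = 0
triangle (suc k) = suc k + triangle k

triangle-closed : ∀ k → k * (k + 1) / 2 ≡ triangle k
triangle-closed k = trans (cong (_/ 2) (double k)) (m*n/n≡m (triangle k) 2)
  where
  double : ∀ k → k * (k + 1) ≡ triangle k * 2
  double zero    = refl
  double (suc k) = begin
    suc k * (suc k + 1)        ≡⟨ expand k ⟩
    suc k * 2 + k * (k + 1)    ≡⟨ cong (suc k * 2 +_) (double k) ⟩
    suc k * 2 + triangle k * 2 ≡⟨ *-distribʳ-+ 2 (suc k) (triangle k) ⟨
    triangle (suc k) * 2       ∎
    where
    open ≡-Reasoning
    expand : ∀ k → suc k * (suc k + 1) ≡ suc k * 2 + k * (k + 1)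
    expand = solve-∀

k≤triangle : ∀ k → k ≤ triangle k
k≤triangle zero    = z≤n
k≤triangle (suc k) = m≤m+n (suc k) (triangle k)

-- Pigeonhole for repetition-free lists.

module _ {a} {A : Set a} where

  ∈-─⁺ : ∀ {x z : A} {ys} (p : x ∈ᴸ ys) → x ≢ z → z ∈ᴸ ys → z ∈ᴸ (ys ─ p)
  ∈-─⁺ (here refl) x≢z (here refl) = contradiction refl x≢z
  ∈-─⁺ (here refl) x≢z (there q)   = q
  ∈-─⁺ (there p)   x≢z (here refl) = here refl
  ∈-─⁺ (there p)   x≢z (there q)   = there (∈-─⁺ p x≢z q)

  -- Delete from `ys` the position of the head of `xs`: the remaining elements of `xs` differ from
  -- that head, so they all survive.
  unique-⊆⇒length≤ : ∀ {xs ys : List A} → Unique xs → All (_∈ᴸ ys) xs → length xs ≤ length ys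
  unique-⊆⇒length≤ []       []       = z≤n
  unique-⊆⇒length≤ {ys = ys} (x∉ ∷ u) (p ∷ ps) rewrite length-removeAt′ ys (index p) =
    s≤s (unique-⊆⇒length≤ u (All.zipWith (λ (x≢z , q) → ∈-─⁺ p x≢z q) (x∉ , ps)))

-- Weights, zeros and setting single coordinates.

weight : Q n → ℕ
weight = countᵇ id

zeros : Q n → ℕ
zeros = countᵇ not

-- When `y ⪯ c`, a coordinate of the pair (y, c) is (0,1), (1,1) or (0,0), and the three summands
-- count these cases.
d+weight+zeros≡n : ∀ {y c : Q n} → y ⪯ c → d c y + (weight y + zeros c) ≡ n
d+weight+zeros≡n [] = refl
d+weight+zeros≡n (f≤t ∷ y⪯c) = cong suc (d+weight+zeros≡n y⪯c)
d+weight+zeros≡n {y = true ∷ y} {_ ∷ c} (b≤b ∷ y⪯c) =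
  trans (+-suc (d c y) _) (cong suc (d+weight+zeros≡n y⪯c))
d+weight+zeros≡n {y = false ∷ y} {_ ∷ c} (b≤b ∷ y⪯c) =
  trans (cong (d c y +_) (+-suc (weight y) _))
        (trans (+-suc (d c y) _) (cong suc (d+weight+zeros≡n y⪯c)))

zero-coordinate : ∀ (c : Q n) → 0 < zeros c → ∃ λ i → lookup c i ≡ false
zero-coordinate (false ∷ c) _ = zero , refl
zero-coordinate (true  ∷ c) p = let i , eq = zero-coordinate c p in suc i , eq

weight-0 : ∀ n → weight (replicate n false) ≡ 0
weight-0 zero    = refl
weight-0 (suc n) = weight-0 n

weight-set : ∀ (y : Q n) i → weight (y [ i ]≔ true) ≤ suc (weight y)
weight-set (false ∷ y) zero    = ≤-refl
weight-set (true  ∷ y) zero    = n≤1+n _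
weight-set (false ∷ y) (suc i) = weight-set y i
weight-set (true  ∷ y) (suc i) = s≤s (weight-set y i)

lookup-set : ∀ (y : Q n) i j → lookup y j ≡ true → lookup (y [ i ]≔ true) j ≡ true
lookup-set (_ ∷ y) zero    zero    eq = refl
lookup-set (_ ∷ y) zero    (suc j) eq = eq
lookup-set (_ ∷ y) (suc i) zero    eq = eq
lookup-set (_ ∷ y) (suc i) (suc j) eq = lookup-set y i j eq

record Avoids (y c : Q n) : Set where
  constructor avoids-at
  field
    coordinate : Fin n
    one-in-y   : lookup y coordinate ≡ true
    zero-in-c  : lookup c coordinate ≡ false

avoids⇒⋠ : ∀ {y c : Q n} → Avoids y c → ¬ y ⪯ c
avoids⇒⋠ (avoids-at i yi ci) y⪯c with subst₂ Bool._≤_ yi ci (Pointwise.lookup y⪯c i)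
... | ()

avoids-set : ∀ {y c : Q n} i → Avoids y c → Avoids (y [ i ]≔ true) c
avoids-set {y = y} i (avoids-at j yj cj) = avoids-at j (lookup-set y i j yj) cj

set-avoids : ∀ (y : Q n) {c} i → lookup c i ≡ false → Avoids (y [ i ]≔ true) c
set-avoids y i ci = avoids-at i (lookup∘update i y true) ci

-- Counting zeros of a list of words by coordinates.

zerosAt : Fin n → List (Q n) → ℕ
zerosAt i L = sum (map (λ c → if lookup c i then 0 else 1) L)

totalZeros : List (Q n) → ℕ
totalZeros L = sum (map zeros L)

zerosAt-tail : ∀ (L : List (Q (suc n))) i → zerosAt i (map tail L) ≡ zerosAt (suc i) L
zerosAt-tail []            i = refl
zerosAt-tail ((_ ∷ c) ∷ L) i = cong (_ +_) (zerosAt-tail L i)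

totalZeros-tail : ∀ (L : List (Q (suc n))) →
                  totalZeros L ≡ zerosAt zero L + totalZeros (map tail L)
totalZeros-tail [] = refl
totalZeros-tail ((false ∷ c) ∷ L) =
  cong suc (trans (cong (zeros c +_) (totalZeros-tail L))
                  (x∙yz≈y∙xz (zeros c) (zerosAt zero L) (totalZeros (map tail L))))
totalZeros-tail ((true ∷ c) ∷ L) =
  trans (cong (zeros c +_) (totalZeros-tail L))
        (x∙yz≈y∙xz (zeros c) (zerosAt zero L) (totalZeros (map tail L)))

totalZeros-Q0 : ∀ (L : List (Q 0)) → totalZeros L ≡ 0
totalZeros-Q0 []       = refl
totalZeros-Q0 ([] ∷ L) = totalZeros-Q0 L

-- If at most one word vanishes at the first coordinate, dropping it lowers the total by at most 1,
-- so the total still exceeds the number of coordinates left.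
common-zero : ∀ n (L : List (Q n)) → n < totalZeros L → ∃ λ i → 2 ≤ zerosAt i L
common-zero zero    L p = contradiction (totalZeros-Q0 L) (>⇒≢ p)
common-zero (suc n) L p with 2 ≤? zerosAt zero L
... | yes q = zero , q
... | no ¬q =
  let i , q = common-zero n (map tail L) (≤-pred (begin
        suc (suc n)                                ≤⟨ p ⟩
        totalZeros L                               ≡⟨ totalZeros-tail L ⟩
        zerosAt zero L + totalZeros (map tail L)   ≤⟨ +-monoˡ-≤ _ (≤-pred (≰⇒> ¬q)) ⟩
        1 + totalZeros (map tail L)                ∎))
  in suc i , subst (2 ≤_) (zerosAt-tail L i) q
  where open ≤-Reasoning

-- Choose i, and one further zero for every word of L that does not vanish at i.
avoid-all : ∀ i {y₀ : Q n} (L : List (Q n)) → All (Avoids y₀) L →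
            ∃ λ y → lookup y i ≡ true × All (Avoids y) L ×
                    weight y + zerosAt i L ≤ 1 + length L
avoid-all {n} i [] [] =
  let 0ⁿ = replicate n false in
  0ⁿ [ i ]≔ true , lookup∘update i 0ⁿ true , [] , (begin
    weight (0ⁿ [ i ]≔ true) + 0 ≡⟨ +-identityʳ _ ⟩
    weight (0ⁿ [ i ]≔ true)     ≤⟨ weight-set 0ⁿ i ⟩
    suc (weight 0ⁿ)             ≡⟨ cong suc (weight-0 n) ⟩
    1                           ∎)
  where open ≤-Reasoning
avoid-all i (c ∷ L) (avoids-at j _ cj ∷ hs) with avoid-all i L hs | lookup c i in ci
... | y , yi , as , w≤ | false = y , yi , avoids-at i yi ci ∷ as , (begin
    weight y + suc (zerosAt i L)   ≡⟨ +-suc (weight y) _ ⟩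
    suc (weight y + zerosAt i L)   ≤⟨ s≤s w≤ ⟩
    2 + length L                   ∎)
  where open ≤-Reasoning
... | y , yi , as , w≤ | true =
  y [ j ]≔ true , lookup-set y j i yi , set-avoids y j cj ∷ All.map (avoids-set j) as , (begin
    weight (y [ j ]≔ true) + zerosAt i L ≤⟨ +-monoˡ-≤ _ (weight-set y j) ⟩
    suc (weight y + zerosAt i L)         ≤⟨ s≤s w≤ ⟩
    2 + length L                         ∎)
  where open ≤-Reasoning

-- Lower bounds by the greedy procedure.

module Greedy {n r} (r≤n : r ≤ n) {C : List (Q n)} (covers : DownwardCovers (n ∸ r) C) where

  -- The state of the greedy search: `L` lists codewords found so far, and since `y` avoids them,
  -- any codeword above `y` is new.
  record Chain (L : List (Q n)) (y : Q n) : Set where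
    field
      unique  : Unique L
      members : All (_∈ᴸ C) L
      avoids  : All (Avoids y) L

  open Chain

  covering-word : ∀ y k → weight y + k ≤ r → ∃ λ c → c ∈ᴸ C × y ⪯ c × k ≤ zeros c
  covering-word y k w+k≤r =
    let c , c∈C , y⪯c , d≤ = find (covers y) in
    -- The distance is at most n - r, so `weight y + zeros c` is at least r; cancelling `weight y`
    -- leaves the bound on zeros.
    c , c∈C , y⪯c , +-cancelˡ-≤ (weight y) _ _ (≤-trans w+k≤r (+-cancelˡ-≤ (n ∸ r) _ _ (begin
      n ∸ r + r                       ≡⟨ m∸n+n≡m r≤n ⟩
      n                               ≡⟨ d+weight+zeros≡n y⪯c ⟨
      d c y + (weight y + zeros c)    ≤⟨ +-monoˡ-≤ _ d≤ ⟩
      n ∸ r + (weight y + zeros c)    ∎)))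
    where open ≤-Reasoning

  fresh : ∀ {L y c} → Chain L y → y ⪯ c → All (c ≢_) L
  fresh ch y⪯c = All.map (λ { a refl → avoids⇒⋠ a y⪯c }) (avoids ch)

  -- Here `k` is the number of rounds left. With `suc k` rounds left the word found has at least
  -- `suc k` zeros, which sums to `triangle k` over `k` rounds.
  greedy : ∀ k {L y} → Chain L y → weight y + k ≤ r →
           ∃₂ λ L′ y′ → Chain L′ y′ × weight y′ ≤ r × length L′ ≡ k + length L ×
                        triangle k + totalZeros L ≤ totalZeros L′
  greedy zero {L} {y} ch w≤r = L , y , ch , subst (_≤ r) (+-identityʳ _) w≤r , refl , ≤-refl
  greedy (suc k) {L} {y} ch w≤r =
    let c , c∈C , y⪯c , k<zeros = covering-word y (suc k) w≤r
        i , ci = zero-coordinate c (≤-trans (s≤s z≤n) k<zeros)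
        ch′ = record
          { unique  = fresh ch y⪯c ∷ unique ch
          ; members = c∈C ∷ members ch
          ; avoids  = set-avoids y i ci ∷ All.map (avoids-set i) (avoids ch)
          }
        L′ , y′ , ch″ , w′≤r , len , tot =
          greedy k ch′ (begin
            weight (y [ i ]≔ true) + k ≤⟨ +-monoˡ-≤ k (weight-set y i) ⟩
            suc (weight y) + k         ≡⟨ +-suc (weight y) k ⟨
            weight y + suc k           ≤⟨ w≤r ⟩
            r                          ∎)
    in L′ , y′ , ch″ , w′≤r , trans len (+-suc k (length L)) , (begin
         suc k + triangle k + totalZeros L   ≡⟨ xy∙z≈y∙xz (suc k) (triangle k) (totalZeros L) ⟩
         triangle k + (suc k + totalZeros L) ≤⟨ +-monoʳ-≤ (triangle k) (+-monoˡ-≤ _ k<zeros) ⟩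
         triangle k + (zeros c + totalZeros L) ≤⟨ tot ⟩
         totalZeros L′                       ∎)
    where
    open ≤-Reasoning

  -- The inequality is strict because after `k` rounds the weight is still at most r, so a further
  -- codeword lies above `y′`; it may have no zeros.
  greedy-bound : ∀ k {L y} → Chain L y → weight y + k ≤ r → k + length L < length C
  greedy-bound k {L} ch w≤r =
    let L′ , y′ , ch′ , w′≤r , len , _ = greedy k ch w≤r
        c , c∈C , y⪯c , _ = covering-word y′ 0 (subst (_≤ r) (sym (+-identityʳ _)) w′≤r)
    in subst (_< length C) len
         (unique-⊆⇒length≤ (fresh ch′ y⪯c ∷ unique ch′) (c∈C ∷ members ch′))

  empty-chain : Chain [] (replicate n false)
  empty-chain = record { unique = [] ; members = [] ; avoids = [] }

  weight-bound : weight (replicate n false) + r ≤ r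
  weight-bound = ≤-reflexive (cong (_+ r) (weight-0 n))

  lower-bound : r < length C
  lower-bound = subst (_< length C) (+-identityʳ r) (greedy-bound r empty-chain weight-bound)

  strict-lower-bound : n < triangle r → suc r < length C
  strict-lower-bound n<tri =
    let L , _ , ch , _ , len , tot = greedy r empty-chain weight-bound
        len′ = trans len (+-identityʳ r)
        -- The summand 0 in `tot` is the zero count of the empty starting list.
        i , 2≤ = common-zero n L (≤-trans n<tri (≤-trans (m≤m+n _ 0) tot))
        y , _ , as , w≤ = avoid-all i L (avoids ch)
        ch′ = record { unique = unique ch ; members = members ch ; avoids = as }
    -- The common zero saves one unit of weight: `weight y + 1 ≤ r` allows one more round, and with
    -- the final covering word this gives two codewords beyond the r in `L`.
    in subst (λ l → suc l < length C) len′ (greedy-bound 1 ch′ (≤-pred (begin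
         suc (weight y + 1)       ≡⟨ +-suc (weight y) 1 ⟨
         weight y + 2             ≤⟨ +-monoʳ-≤ (weight y) 2≤ ⟩
         weight y + zerosAt i L   ≤⟨ w≤ ⟩
         1 + length L             ≡⟨ cong suc len′ ⟩
         suc r                    ∎)))
    where open ≤-Reasoning

-- Covers with disjoint zero sets.

⪯-1 : ∀ (y : Q n) → y ⪯ replicate n true
⪯-1 []          = []
⪯-1 (false ∷ y) = f≤t ∷ ⪯-1 y
⪯-1 (true  ∷ y) = b≤b ∷ ⪯-1 y

d≤n : ∀ (x y : Q n) → d x y ≤ n
d≤n x y = count≤n _ (Vec.zipWith Bool._xor_ x y)

d-++ : ∀ (a b : Q m) (x y : Q n) → d (a ++ x) (b ++ y) ≡ d a b + d x y
d-++ []          []          x y = refl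
d-++ (false ∷ a) (false ∷ b) x y = d-++ a b x y
d-++ (false ∷ a) (true  ∷ b) x y = cong suc (d-++ a b x y)
d-++ (true  ∷ a) (false ∷ b) x y = cong suc (d-++ a b x y)
d-++ (true  ∷ a) (true  ∷ b) x y = d-++ a b x y

0⊎d1<n : ∀ (a : Q n) → a ≡ replicate n false ⊎ d (replicate n true) a < n
0⊎d1<n []          = inj₁ refl
0⊎d1<n (true  ∷ a) = inj₂ (s≤s (d≤n (replicate _ true) a))
0⊎d1<n (false ∷ a) with 0⊎d1<n a
... | inj₁ eq = inj₁ (cong (false ∷_) eq)
... | inj₂ lt = inj₂ (s≤s lt)

-- Induction on r: prepend a block of r + 1 coordinates, filled with ones in the old codewords and
-- with zeros in one new codeword that is 1 elsewhere.
optimal-cover : ∀ r n → triangle r ≤ n → HasCoverOfSize n (n ∸ r) (r + 1)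
optimal-cover zero n _ =
  replicate n true ∷ [] , refl , [] ∷ [] , λ y → here (⪯-1 y , d≤n (replicate n true) y)
optimal-cover (suc r) n tri≤n with m≤n⇒∃[o]m+o≡n (m+n≤o⇒m≤o (suc r) tri≤n)
... | n′ , refl with optimal-cover r n′ (+-cancelˡ-≤ (suc r) _ _ tri≤n)
... | C , len , uniq , cov =
    (0ʳ ++ 1ⁿ) ∷ map (1ʳ ++_) C
  , cong suc (trans (length-map (1ʳ ++_) C) len)
  -- The new codeword differs from the old ones already in the first coordinate of the nonempty
  -- block.
  , All.map⁺ (All.universal (λ _ ()) C) ∷ Unique.map⁺ (++-injectiveʳ 1ʳ 1ʳ) uniq
  , covers
  where
  0ʳ 1ʳ : Q (suc r)
  0ʳ = replicate (suc r) false
  1ʳ = replicate (suc r) true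

  1ⁿ : Q n′
  1ⁿ = replicate n′ true

  r≤n′ : r ≤ n′
  r≤n′ = ≤-trans (k≤triangle r) (+-cancelˡ-≤ (suc r) _ _ tri≤n)

  open ≤-Reasoning

  covers : DownwardCovers (suc r + n′ ∸ suc r) ((0ʳ ++ 1ⁿ) ∷ map (1ʳ ++_) C)
  covers y with splitAt (suc r) y
  ... | a , b , refl with 0⊎d1<n a
  ... | inj₁ refl = here (Pointwise.++⁺ (⪯-refl {x = 0ʳ}) (⪯-1 b) , (begin
    d (0ʳ ++ 1ⁿ) (0ʳ ++ b)   ≡⟨ d-++ 0ʳ 0ʳ 1ⁿ b ⟩
    d 0ʳ 0ʳ + d 1ⁿ b         ≡⟨ cong (_+ d 1ⁿ b) (d-self 0ʳ) ⟩
    d 1ⁿ b                   ≤⟨ d≤n 1ⁿ b ⟩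
    n′                       ≡⟨ m+n∸m≡n (suc r) n′ ⟨
    suc r + n′ ∸ suc r       ∎))
  -- A one in `a` leaves distance at most r on the block, so the total is at most r + (n′ - r) = n′,
  -- the allowed radius.
  ... | inj₂ (s≤s d1a≤r) = there (Any.map⁺ (Any.map extend (cov b)))
    where
    extend : ∀ {c} → b ∈ B⁻ c (n′ ∸ r) → (a ++ b) ∈ B⁻ (1ʳ ++ c) (suc r + n′ ∸ suc r)
    extend {c} (b⪯c , dcb≤) = Pointwise.++⁺ (⪯-1 a) b⪯c , (begin
      d (1ʳ ++ c) (a ++ b)   ≡⟨ d-++ 1ʳ a c b ⟩
      d 1ʳ a + d c b         ≤⟨ +-mono-≤ d1a≤r dcb≤ ⟩
      r + (n′ ∸ r)           ≡⟨ m+[n∸m]≡n r≤n′ ⟩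
      n′                     ≡⟨ m+n∸m≡n (suc r) n′ ⟨
      suc r + n′ ∸ suc r     ∎)

theorem13 : ∀ (n R̄ : ℕ) → n ≥ 1 → R̄ ≤ n →
    (K⁺ n (n ∸ R̄) ≥ R̄ + 1)
    × (n ≥ (R̄ * (R̄ + 1)) / 2 → K⁺ n (n ∸ R̄) ≡ R̄ + 1)
    × (n < (R̄ * (R̄ + 1)) / 2 → K⁺ n (n ∸ R̄) > R̄ + 1)
theorem13 n R̄ _ R̄≤n rewrite triangle-closed R̄
  -- Abstracting `K⁺` lets `refl` identify it with the length of a minimum cover `C`, to which both
  -- lower bounds apply.
  with K⁺ n (n ∸ R̄) | K⁺-isMinimum n (n ∸ R̄)
... | _ | (C , refl , _ , covers) , minimal =
    lower
  , (λ tri≤n → ≤-antisym (minimal (R̄ + 1) (optimal-cover R̄ n tri≤n)) lower)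
  , λ n<tri → subst (_< length C) (+-comm 1 R̄) (strict-lower-bound n<tri)
  where
  open Greedy R̄≤n covers
  lower : R̄ + 1 ≤ length C
  lower = subst (_≤ length C) (+-comm 1 R̄) lower-bound
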